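{- For every relation $r\subseteq\Sigma\times\Sigma$ and every variable $x\in V$: (1) if $\mathsf E_xr=\mathsf E^{\mathsf{last}}_xr$, then $\mathbf{guar}(\mathsf E_xr)=\mathsf E_x(\mathbf{guar}\,r)$; (2) if $\mathsf E_xr=\mathsf E^{\mathsf{last}}_xr$, then $\mathbf{demand}(\mathsf E_xr)=\mathsf E_x(\mathbf{demand}\,r)$; (3) if $\mathsf E_xr=r$, then $\mathbf{rely}(\mathsf E_xr)=\mathsf E_x(\mathbf{rely}\,r)$.
   Context: Commands. $(\mathcal C,\le,\bigwedge,\bigsqcup,\bot,\top)$ is a complete distributive lattice (with arbitrary meet $\bigwedge$, binary meet $\sqcap$, arbitrary join $\bigsqcup$ and binary join $\sqcup$) whose elements are called commands. It has an associative sequential composition $;$ with identity $\mathbf{nil}$, monotone in both arguments, and an associative, commutative, idempotent, monotone weak conjunction $\Cap$. Iterations: $c^0=\mathbf{nil}$, $c^{i+1}=c;c^i$; $c^\star$ (resp. $c^\omega$) is the least (resp. greatest) fixed point of $y\mapsto\mathbf{nil}\sqcup c;y$; $c^\infty=c^\omega;\bot$. One has $c^\star=\bigsqcup_{i\in\mathbb N}c^i$ and $c^\omega=c^\star\sqcup c^\infty$. States and relations. $V$ is a countable set of variables, $S$ a set, $\Sigma$ the set of partial functions $V\rightharpoonup S$. $\mathrm{id}(\overline x)$ relates $\sigma,\sigma'\in\Sigma$ iff they agree on every variable other than $x$. For $p\subseteq\Sigma$, $\mathsf E_x p$ is the image of $p$ under $\mathrm{id}(\overline x)$. For $r\subseteq\Sigma\times\Sigma$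 (with $\circ$ denoting left-to-right relational composition), $\mathsf E^{\mathsf{first}}_x r=\mathrm{id}(\overline x)\circ r$, $\mathsf E^{\mathsf{last}}_x r=r\circ\mathrm{id}(\overline x)$, $\mathsf E_x r=\mathrm{id}(\overline x)\circ r\circ\mathrm{id}(\overline x)$. $\overline r$ is the complement of $r$ in $\Sigma\times\Sigma$. Primitive commands. $\tau:\mathcal P(\Sigma)\to\mathcal C$ (tests) and $\pi,\epsilon:\mathcal P(\Sigma\times\Sigma)\to\mathcal A$ (program and environment steps) are injective homomorphisms of complete Boolean algebras onto complete Boolean sub-algebras of $\mathcal C$ (joins, and nonempty meets, computed in $\mathcal C$; complement relative to the greatest element of the sub-algebra), with $\tau(\emptyset)=\pi(\emptyset)=\epsilon(\emptyset)=\bot$ and $\tau(\Sigma)=\mathbf{nil}$. $\mathcal A\subseteq\mathcal C$ is the complete Boolean sub-algebra of atomic steps, in which $\boldsymbol\pi=\pi(\Sigma\times\Sigma)$ and $\boldsymbol\epsilon=\epsilon(\Sigma\times\Sigma)$ are complementary; $\boldsymbol\alpha=\boldsymbol\pi\sqcup\boldsymbol\epsilon$. $\mathbf{chaos}=\boldsymbol\alpha^\omega$ is the identity of $\Cap$, and $a=a\Cap(\boldsymbol\alpha;\mathbf{chaos})$ for all $a\in\mathcal A$. Localisation. For each $x\in V$ there are unary operators $\mathsf E_x,\mathsf E^{\mathsf{first}}_x,\mathsf E^{\mathsf{last}}_x$ on $\mathcal C$ (binding tighter than binary operators). Each family $F\in\{\mathsf E,\mathsf E^{\mathsf{first}},\mathsf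 E^{\mathsf{last}}\}$ satisfies $c\le F_xc$; $F_x(c\sqcap F_xd)=F_xc\sqcap F_xd$; $F_xF_yc=F_yF_xc$; $F_x(\bigsqcup C)=\bigsqcup_{c\in C}F_xc$. Further axioms: $\mathsf E^{\mathsf{first}}_xc\le\mathsf E_xc$; $\mathsf E^{\mathsf{last}}_xc\le\mathsf E_xc$; $\mathsf E_x\mathsf E^{\mathsf{first}}_yc=\mathsf E^{\mathsf{first}}_y\mathsf E_xc$; $\mathsf E_x\mathsf E^{\mathsf{last}}_yc=\mathsf E^{\mathsf{last}}_y\mathsf E_xc$; $\mathsf E^{\mathsf{first}}_x\mathsf E^{\mathsf{last}}_yc=\mathsf E^{\mathsf{last}}_y\mathsf E^{\mathsf{first}}_xc$; $\mathsf E_x\tau(p)=\mathsf E^{\mathsf{first}}_x\tau(p)=\mathsf E^{\mathsf{last}}_x\tau(p)=\tau(\mathsf E_xp)$; $F_x\pi(r)=\pi(F_xr)$ and $F_x\epsilon(r)=\epsilon(F_xr)$ for each of the three $F$; $\mathsf E_x(c;\mathsf E^{\mathsf{first}}_xd)=\mathsf E_xc;\mathsf E_xd=\mathsf E_x(\mathsf E^{\mathsf{last}}_xc;d)$; if $c=c\Cap(\boldsymbol\alpha;\mathbf{chaos})$ then $\mathsf E^{\mathsf{first}}_x(c;d)=\mathsf E^{\mathsf{first}}_xc;d$ and $\mathsf E^{\mathsf{last}}_x(d;c)=d;\mathsf E^{\mathsf{last}}_xc$; $\mathsf E_x(c\Cap\mathsf E_xd)=\mathsf E_xc\Cap\mathsf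 E_xd$; $\mathsf E^{\mathsf{first}}_x(c\Cap\mathsf E^{\mathsf{first}}_xd)=\mathsf E^{\mathsf{first}}_xc\Cap\mathsf E^{\mathsf{first}}_xd$; for $a\in\mathcal A$ with $\mathsf E_xa=\mathsf E^{\mathsf{last}}_xa$, $\mathsf E_x(a^\infty)=(\mathsf E_xa)^\infty$. Derived commands. $\mathbf{guar}\,g=(\pi(g)\sqcup\boldsymbol\epsilon)^\omega$; $\mathbf{demand}\,r=(\epsilon(r)\sqcup\boldsymbol\pi)^\omega$; $\mathbf{rely}\,r=(\boldsymbol\alpha\sqcup\epsilon(\overline r);\top)^\omega$, and in this algebra $\mathbf{rely}\,r=\boldsymbol\alpha^\omega;(\mathbf{nil}\sqcup\epsilon(\overline r);\top)$. -}

module Defs where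

open import Level using (Level; Lift; lower) renaming (suc to lsuc)
open import Data.Maybe using (Maybe)
open import Data.Nat using (ℕ; zero; suc)
open import Data.Product using (_×_; _,_; ∃; ∃-syntax)
open import Relation.Binary using (Rel)
open import Relation.Binary.Definitions using (Monotonic₂; Maximum; Minimum)
open import Relation.Binary.Lattice using (IsDistributiveLattice)
open import Relation.Binary.PropositionalEquality using (_≡_; _≢_)
open import Relation.Unary using (Pred; _∈_; _≐_; ∁; ⋃; ⋂; _⟨∘⟩_)
open import Relation.Unary.Polymorphic using (∅; U)
open import Algebra.Core using (Op₁; Op₂)
import Algebra.Definitions as AlgDefs

-- Subsets of X are predicates X → Set ℓ, compared by mutual inclusion _≐_.
module States {ℓ : Level} (V S : Set ℓ) where

  -- Partial functions V ⇀ S.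
  State : Set ℓ
  State = V → Maybe S

  StatePred : Set (lsuc ℓ)
  StatePred = Pred State ℓ

  StateRel : Set (lsuc ℓ)
  StateRel = Pred (State × State) ℓ

  -- id(x̄)
  idOff : V → StateRel
  idOff x (σ , σ′) = ∀ y → y ≢ x → σ y ≡ σ′ y

  Eᵖ : V → StatePred → StatePred
  Eᵖ x p σ′ = ∃[ σ ] (σ ∈ p × (σ , σ′) ∈ idOff x)

  Eʳ-first Eʳ-last Eʳ : V → StateRel → StateRel
  Eʳ-first x r = idOff x ⟨∘⟩ r
  Eʳ-last  x r = r ⟨∘⟩ idOff x
  Eʳ       x r = idOff x ⟨∘⟩ (r ⟨∘⟩ idOff x)

record CompleteDistributiveLattice (ℓ : Level) : Set (lsuc ℓ) where
  infix  4 _≈_ _≤_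
  infixr 6 _⊔_
  infixr 7 _⊓_
  field
    Carrier : Set ℓ
    _≈_ _≤_ : Rel Carrier ℓ
    _⊔_ _⊓_ : Op₂ Carrier
    ⊤ ⊥     : Carrier
    ⨆ ⨅     : {I : Set ℓ} → (I → Carrier) → Carrier

    isDistributiveLattice : IsDistributiveLattice _≈_ _≤_ _⊔_ _⊓_
    maximum    : Maximum _≤_ ⊤
    minimum    : Minimum _≤_ ⊥
    ⨆-upper    : ∀ {I : Set ℓ} (f : I → Carrier) i → f i ≤ ⨆ f
    ⨆-least    : ∀ {I : Set ℓ} (f : I → Carrier) c → (∀ i → f i ≤ c) → ⨆ f ≤ c
    ⨅-lower    : ∀ {I : Set ℓ} (f : I → Carrier) i → ⨅ f ≤ f i
    ⨅-greatest : ∀ {I : Set ℓ} (f : I → Carrier) c → (∀ i → c ≤ f i) → c ≤ ⨅ f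

  open IsDistributiveLattice isDistributiveLattice public

  IsLeastFixedPoint IsGreatestFixedPoint : (Carrier → Carrier) → Carrier → Set ℓ
  IsLeastFixedPoint    f c = f c ≈ c × (∀ d → f d ≈ d → c ≤ d)
  IsGreatestFixedPoint f c = f c ≈ c × (∀ d → f d ≈ d → d ≤ c)

  -- b is the complement of a relative to the greatest element t of a
  -- subalgebra (whose least element is ⊥).
  IsComplement : (t a b : Carrier) → Set ℓ
  IsComplement t a b = a ⊔ b ≈ t × a ⊓ b ≈ ⊥

  -- B is a complete Boolean algebra with greatest element t, whose joins and
  -- nonempty meets are those of the ambient lattice.
  record IsCompleteBooleanSubalgebra (B : Pred Carrier ℓ) (t : Carrier) : Set (lsuc ℓ) where
    field
      resp-≈            : ∀ {a b} → a ≈ b → a ∈ B → b ∈ B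
      ⨆-closed          : ∀ {I : Set ℓ} (f : I → Carrier) → (∀ i → f i ∈ B) → ⨆ f ∈ B
      ⨅-closed          : ∀ {I : Set ℓ} → I → (f : I → Carrier) → (∀ i → f i ∈ B) → ⨅ f ∈ B
      top-∈             : t ∈ B
      top-greatest      : ∀ {a} → a ∈ B → a ≤ t
      complement-closed : ∀ {a} → a ∈ B → ∃[ b ] (b ∈ B × IsComplement t a b)

  -- f is an injective homomorphism of complete Boolean algebras from the
  -- powerset of X onto its image, a complete Boolean subalgebra with greatest
  -- element f U. Complementation makes this meaningful only classically:
  -- with injectivity it gives excluded middle for Set ℓ when X is inhabited.
  record IsPowersetEmbedding {X : Set ℓ} (f : Pred X ℓ → Carrier) : Set (lsuc ℓ) where
    field
      cong      : ∀ {p q} → p ≐ q → f p ≈ f q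
      injective : ∀ {p q} → f p ≈ f q → p ≐ q
      ∅-homo    : f ∅ ≈ ⊥
      ⋃-homo    : ∀ {I : Set ℓ} (p : I → Pred X ℓ) → f (⋃ I p) ≈ ⨆ (λ i → f (p i))
      ⋂-homo    : ∀ {I : Set ℓ} → I → (p : I → Pred X ℓ) → f (⋂ I p) ≈ ⨅ (λ i → f (p i))
      ∁-homo    : ∀ p → IsComplement (f U) (f p) (f (∁ p))

record CommandAlgebra (ℓ : Level) : Set (lsuc ℓ) where
  field
    lattice : CompleteDistributiveLattice ℓ

  open CompleteDistributiveLattice lattice public renaming (Carrier to Command)
  open AlgDefs _≈_ using (Associative; Commutative; Idempotent; Identity)

  infixr 8 _⨾_
  infixr 7 _⋒_
  infix  9 _⋆ _^ω _^∞
  infixr 9 _^_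

  field
    _⨾_        : Op₂ Command
    nil        : Command
    ⨾-assoc    : Associative _⨾_
    ⨾-identity : Identity nil _⨾_
    ⨾-mono     : Monotonic₂ _≤_ _≤_ _≤_ _⨾_

    _⋒_     : Op₂ Command
    ⋒-assoc : Associative _⋒_
    ⋒-comm  : Commutative _⋒_
    ⋒-idem  : Idempotent _⋒_
    ⋒-mono  : Monotonic₂ _≤_ _≤_ _≤_ _⋒_

    _⋆ _^ω     : Op₁ Command
    ⋆-least    : ∀ c → IsLeastFixedPoint    (λ y → nil ⊔ c ⨾ y) (c ⋆)
    ω-greatest : ∀ c → IsGreatestFixedPoint (λ y → nil ⊔ c ⨾ y) (c ^ω)

  _^_ : Command → ℕ → Command
  c ^ zero  = nil
  c ^ suc i = c ⨾ c ^ i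

  _^∞ : Op₁ Command
  c ^∞ = c ^ω ⨾ ⊥

record ConcurrentAlgebra {ℓ : Level} (V S : Set ℓ) : Set (lsuc ℓ) where
  open States V S

  field
    commandAlgebra : CommandAlgebra ℓ

  open CommandAlgebra commandAlgebra public
  open AlgDefs _≈_ using (Identity)

  field
    ⋆-powers    : ∀ c → c ⋆ ≈ ⨆ {I = Lift ℓ ℕ} (λ i → c ^ lower i)
    ω-isolation : ∀ c → c ^ω ≈ c ⋆ ⊔ c ^∞

    τ   : StatePred → Command
    π ε : StateRel → Command
    τ-embedding : IsPowersetEmbedding τ
    π-embedding : IsPowersetEmbedding π
    ε-embedding : IsPowersetEmbedding ε
    τ-U         : τ U ≈ nil

  𝛑 : Command
  𝛑 = π U

  𝛆 : Command
  𝛆 = ε U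

  𝛂 : Command
  𝛂 = 𝛑 ⊔ 𝛆

  chaos : Command
  chaos = 𝛂 ^ω

  -- Since 𝛑 and 𝛆 are complementary in 𝒜, 𝛂 is the greatest element of 𝒜.
  field
    𝒜              : Pred Command ℓ
    𝒜-subalgebra   : IsCompleteBooleanSubalgebra 𝒜 𝛂
    π-atomic       : ∀ r → π r ∈ 𝒜
    ε-atomic       : ∀ r → ε r ∈ 𝒜
    𝛑-𝛆-complement : IsComplement 𝛂 𝛑 𝛆

    ⋒-identity : Identity chaos _⋒_
    atomic-⋒   : ∀ {a} → a ∈ 𝒜 → a ≈ a ⋒ (𝛂 ⨾ chaos)

  guar : StateRel → Command
  guar g = (π g ⊔ 𝛆) ^ω

  demand : StateRel → Command
  demand r = (ε r ⊔ 𝛑) ^ω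

  rely : StateRel → Command
  rely r = (𝛂 ⊔ ε (∁ r) ⨾ ⊤) ^ω

  field
    rely-expand : ∀ r → rely r ≈ 𝛂 ^ω ⨾ (nil ⊔ ε (∁ r) ⨾ ⊤)

  -- The axioms common to E, E-first and E-last; Fʳ is the corresponding
  -- operator on relations.
  record IsLocalisation (F : V → Command → Command)
                        (Fʳ : V → StateRel → StateRel) : Set (lsuc ℓ) where
    field
      cong      : ∀ x {c d} → c ≈ d → F x c ≈ F x d
      extensive : ∀ x c → c ≤ F x c
      ⊓-modular : ∀ x c d → F x (c ⊓ F x d) ≈ F x c ⊓ F x d
      commute   : ∀ x y c → F x (F y c) ≈ F y (F x c)
      ⨆-homo    : ∀ x {I : Set ℓ} (c : I → Command) → F x (⨆ c) ≈ ⨆ (λ i → F x (c i))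
      τ-homo    : ∀ x p → F x (τ p) ≈ τ (Eᵖ x p)
      π-homo    : ∀ x r → F x (π r) ≈ π (Fʳ x r)
      ε-homo    : ∀ x r → F x (ε r) ≈ ε (Fʳ x r)

record LocalisationAlgebra {ℓ : Level} (V S : Set ℓ) : Set (lsuc ℓ) where
  open States V S

  field
    concurrentAlgebra : ConcurrentAlgebra V S

  open ConcurrentAlgebra concurrentAlgebra public

  field
    E E-first E-last : V → Command → Command
    isLocalisation       : IsLocalisation E       Eʳ
    isLocalisation-first : IsLocalisation E-first Eʳ-first
    isLocalisation-last  : IsLocalisation E-last  Eʳ-last

    first≤E : ∀ x c → E-first x c ≤ E x c
    last≤E  : ∀ x c → E-last x c ≤ E x c
    E-first-commute    : ∀ x y c → E x (E-first y c) ≈ E-first y (E x c)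
    E-last-commute     : ∀ x y c → E x (E-last y c) ≈ E-last y (E x c)
    first-last-commute : ∀ x y c → E-first x (E-last y c) ≈ E-last y (E-first x c)

    E-⨾-first : ∀ x c d → E x (c ⨾ E-first x d) ≈ E x c ⨾ E x d
    E-⨾-last  : ∀ x c d → E x (E-last x c ⨾ d) ≈ E x c ⨾ E x d
    first-⨾   : ∀ x c d → c ≈ c ⋒ (𝛂 ⨾ chaos) → E-first x (c ⨾ d) ≈ E-first x c ⨾ d
    last-⨾    : ∀ x c d → c ≈ c ⋒ (𝛂 ⨾ chaos) → E-last x (d ⨾ c) ≈ d ⨾ E-last x c

    E-⋒     : ∀ x c d → E x (c ⋒ E x d) ≈ E x c ⋒ E x d
    first-⋒ : ∀ x c d → E-first x (c ⋒ E-first x d) ≈ E-first x c ⋒ E-first x d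

    E-∞ : ∀ x {a} → a ∈ 𝒜 → E x a ≈ E-last x a → E x (a ^∞) ≈ (E x a) ^∞

{-# OPTIONS --safe #-}

-- If a is atomic and E a = E-last a, then appending a last step to aⁱ gives
--   E (aⁱ ⨾ a) = E (E-last (aⁱ ⨾ a)) = E (aⁱ ⨾ E a) = E (aⁱ) ⨾ E a,
-- where the last equality holds because E a absorbs E-first. So E commutes with
-- all powers of a, hence with a ⋆, and with a ^ω = a ⋆ ⊔ a ^∞. For rely the tail
-- nil ⊔ ε (∁ r) ⨾ ⊤ is invariant under E-first, which splits the composition.
module Submission where

open import Level using (Level; Lift; lift; lower)
open import Data.Bool using (Bool; true; false; if_then_else_)
open import Data.Nat using (ℕ; zero; suc)
open import Data.Product using (_×_; _,_; proj₁; proj₂)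
open import Data.Unit.Polymorphic using (tt)
open import Function.Bundles using (_↣_)
open import Relation.Binary using (Poset)
open import Relation.Binary.Lattice using (JoinSemilattice)
open import Relation.Unary using (_∈_; _≐_; ∁)
open import Relation.Unary.Polymorphic using (U)
import Relation.Binary.Lattice.Properties.JoinSemilattice as JoinSemilatticeProperties
import Relation.Binary.PropositionalEquality as ≡
import Relation.Binary.Reasoning.Setoid as SetoidReasoning
open import Defs

-- Invariance of relations under change of one variable

module StateProperties {ℓ : Level} {V S : Set ℓ} where
  open States V S

  idOff-refl : ∀ x (σ : State) → (σ , σ) ∈ idOff x
  idOff-refl _ _ _ _ = ≡.refl

  idOff-sym : ∀ x {σ σ′ : State} → (σ , σ′) ∈ idOff x → (σ′ , σ) ∈ idOff x
  idOff-sym _ e y y≢x = ≡.sym (e y y≢x)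

  Eᵖ-U : ∀ x → Eᵖ x U ≐ U {ℓ = ℓ}
  Eᵖ-U x = (λ _ → tt) , λ {σ} _ → σ , tt , idOff-refl x σ

  Eʳ-U : ∀ x → Eʳ x U ≐ U {ℓ = ℓ}
  Eʳ-U x = (λ _ → tt) , λ {(σ , σ′)} _ → σ , idOff-refl x σ , σ′ , tt , idOff-refl x σ′

  -- Both sides are full because `idOff x` is reflexive. This makes the side condition of `E-∞` hold
  -- for the unconstrained half of an atomic step.
  Eʳ-U≐last-U : ∀ x → Eʳ x U ≐ Eʳ-last x U
  Eʳ-U≐last-U x =
    (λ {(_ , σ′)} _ → σ′ , tt , idOff-refl x σ′) ,
    (λ { {(σ , _)} e → σ , idOff-refl x σ , e })

  ∁-cong : ∀ {r s : StateRel} → r ≐ s → ∁ r ≐ ∁ s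
  ∁-cong (r⊆s , s⊆r) = (λ ¬r s → ¬r (s⊆r s)) , (λ ¬s r → ¬s (r⊆s r))

  -- By symmetry of `idOff x`, a path from a pair outside `r` to a pair in `r` can be walked back,
  -- which would put the first pair in `r` too.
  Eʳ-∁ : ∀ x {r} → Eʳ x r ≐ r → Eʳ x (∁ r) ≐ ∁ r
  Eʳ-∁ x (Er⊆r , _) =
    (λ { (_ , e , _ , ¬r , e′) r → ¬r (Er⊆r (_ , idOff-sym x e , _ , r , idOff-sym x e′)) }) ,
    (λ {(σ , σ′)} ¬r → σ , idOff-refl x σ , σ′ , ¬r , idOff-refl x σ′)

  Eʳ-first-fixed : ∀ x {r} → Eʳ x r ≐ r → Eʳ-first x r ≐ r
  Eʳ-first-fixed x (Er⊆r , _) =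
    (λ { {(_ , σ′)} (_ , e , r) → Er⊆r (_ , e , σ′ , r , idOff-refl x σ′) }) ,
    (λ {(σ , _)} r → σ , idOff-refl x σ , r)

-- Binary joins from indexed ones

module LatticeProperties {ℓ : Level} (L : CompleteDistributiveLattice ℓ) where
  open CompleteDistributiveLattice L

  joinSemilattice : JoinSemilattice ℓ ℓ ℓ
  joinSemilattice = record { isJoinSemilattice = isJoinSemilattice }

  open JoinSemilattice joinSemilattice public using (poset)
  open JoinSemilatticeProperties joinSemilattice public using () renaming (∨-cong to ⊔-cong; ∨-comm to ⊔-comm)

  ⨆-mono : ∀ {I : Set ℓ} {f g : I → Carrier} → (∀ i → f i ≤ g i) → ⨆ f ≤ ⨆ g
  ⨆-mono {f = f} {g} f≤g = ⨆-least f (⨆ g) λ i → trans (f≤g i) (⨆-upper g i)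

  ⨆-cong : ∀ {I : Set ℓ} {f g : I → Carrier} → (∀ i → f i ≈ g i) → ⨆ f ≈ ⨆ g
  ⨆-cong f≈g = antisym (⨆-mono λ i → reflexive (f≈g i)) (⨆-mono λ i → reflexive (Eq.sym (f≈g i)))

  -- Localisation and subalgebra axioms speak of indexed joins only; a family over two indices turns
  -- them into facts about `_⊔_`.
  pair : Carrier → Carrier → Lift ℓ Bool → Carrier
  pair a b i = if lower i then a else b

  ⨆-pair : ∀ a b → ⨆ (pair a b) ≈ a ⊔ b
  ⨆-pair a b = antisym
    (⨆-least (pair a b) (a ⊔ b) λ { (lift true) → x≤x∨y a b ; (lift false) → y≤x∨y a b })
    (∨-least (⨆-upper (pair a b) (lift true)) (⨆-upper (pair a b) (lift false)))

  ⊔-closed : ∀ {B t} → IsCompleteBooleanSubalgebra B t → ∀ {a b} → a ∈ B → b ∈ B → a ⊔ b ∈ B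
  ⊔-closed sub {a} {b} a∈B b∈B = resp-≈ (⨆-pair a b)
    (⨆-closed (pair a b) λ { (lift true) → a∈B ; (lift false) → b∈B })
    where open IsCompleteBooleanSubalgebra sub

-- Composition and iteration

module CommandProperties {ℓ : Level} (C : CommandAlgebra ℓ) where
  open CommandAlgebra C
  open LatticeProperties lattice
  open SetoidReasoning (Poset.Eq.setoid poset)

  ⨾-cong : ∀ {a b c d} → a ≈ b → c ≈ d → a ⨾ c ≈ b ⨾ d
  ⨾-cong a≈b c≈d = antisym (⨾-mono (reflexive a≈b) (reflexive c≈d))
                           (⨾-mono (reflexive (Eq.sym a≈b)) (reflexive (Eq.sym c≈d)))

  ω-cong : ∀ {c d} → c ≈ d → c ^ω ≈ d ^ω
  ω-cong c≈d = antisym (ω-below c≈d) (ω-below (Eq.sym c≈d))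
    where
    ω-below : ∀ {c d} → c ≈ d → c ^ω ≤ d ^ω
    -- `c ^ω` is also a fixed point of the map for `d`, hence below the greatest one.
    ω-below {c} {d} c≈d = proj₂ (ω-greatest d) (c ^ω) (begin
      nil ⊔ d ⨾ c ^ω ≈⟨ ⊔-cong Eq.refl (⨾-cong (Eq.sym c≈d) Eq.refl) ⟩
      nil ⊔ c ⨾ c ^ω ≈⟨ proj₁ (ω-greatest c) ⟩
      c ^ω           ∎)

  -- Powers unfold on the left, but `last-⨾` needs the atomic step at the right end.
  ^-sucʳ : ∀ c i → c ^ suc i ≈ c ^ i ⨾ c
  ^-sucʳ c zero = Eq.trans (proj₂ ⨾-identity c) (Eq.sym (proj₁ ⨾-identity c))
  ^-sucʳ c (suc i) = begin
    c ⨾ c ^ suc i   ≈⟨ ⨾-cong Eq.refl (^-sucʳ c i) ⟩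
    c ⨾ (c ^ i ⨾ c) ≈⟨ ⨾-assoc c (c ^ i) c ⟨
    c ^ suc i ⨾ c   ∎

module LocalisationProperties {ℓ : Level} {V S : Set ℓ} (A : LocalisationAlgebra V S) where
  open States V S
  open StateProperties {V = V} {S = S}
  open LocalisationAlgebra A
  open LatticeProperties lattice
  open CommandProperties commandAlgebra
  open SetoidReasoning (Poset.Eq.setoid poset)
  module π = IsPowersetEmbedding π-embedding
  module ε = IsPowersetEmbedding ε-embedding
  module 𝐄 = IsLocalisation isLocalisation
  module 𝐄-first = IsLocalisation isLocalisation-first
  module 𝐄-last = IsLocalisation isLocalisation-last

  -- Consequences of the axioms shared by the three operators

  module OneFamily {F Fʳ} (isLoc : IsLocalisation F Fʳ) (x : V) where
    private module 𝐅 = IsLocalisation isLoc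

    F-⊔ : ∀ c d → F x (c ⊔ d) ≈ F x c ⊔ F x d
    F-⊔ c d = begin
      F x (c ⊔ d)                    ≈⟨ 𝐅.cong x (⨆-pair c d) ⟨
      F x (⨆ (pair c d))             ≈⟨ 𝐅.⨆-homo x (pair c d) ⟩
      ⨆ (λ i → F x (pair c d i))     ≈⟨ ⨆-cong (λ { (lift true) → Eq.refl ; (lift false) → Eq.refl }) ⟩
      ⨆ (pair (F x c) (F x d))       ≈⟨ ⨆-pair (F x c) (F x d) ⟩
      F x c ⊔ F x d                  ∎

    F-mono : ∀ {c d} → c ≤ d → F x c ≤ F x d
    F-mono {c} {d} c≤d = trans (x≤x∨y (F x c) (F x d))
      (reflexive (Eq.trans (Eq.sym (F-⊔ c d))
        (𝐅.cong x (antisym (∨-least c≤d refl) (y≤x∨y c d)))))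

    F-⊤ : F x ⊤ ≈ ⊤
    F-⊤ = antisym (maximum _) (𝐅.extensive x ⊤)

    -- This is `⊓-modular` with `⊤` as the first argument, since `F x` fixes `⊤`.
    F-idem : ∀ c → F x (F x c) ≈ F x c
    F-idem c = begin
      F x (F x c)       ≈⟨ 𝐅.cong x (⊤-⊓ (F x c)) ⟨
      F x (⊤ ⊓ F x c)   ≈⟨ 𝐅.⊓-modular x ⊤ c ⟩
      F x ⊤ ⊓ F x c     ≈⟨ antisym (x∧y≤y _ _) (∧-greatest (trans (maximum _) (reflexive (Eq.sym F-⊤))) refl) ⟩
      F x c             ∎
      where
      ⊤-⊓ : ∀ c → ⊤ ⊓ c ≈ c
      ⊤-⊓ c = antisym (x∧y≤y ⊤ c) (∧-greatest (maximum c) refl)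

    F-nil : F x nil ≈ nil
    F-nil = begin
      F x nil     ≈⟨ 𝐅.cong x τ-U ⟨
      F x (τ U)   ≈⟨ 𝐅.τ-homo x U ⟩
      τ (Eᵖ x U)  ≈⟨ IsPowersetEmbedding.cong τ-embedding (Eᵖ-U x) ⟩
      τ U         ≈⟨ τ-U ⟩
      nil         ∎

    F-πε : ∀ r s → F x (π r ⊔ ε s) ≈ π (Fʳ x r) ⊔ ε (Fʳ x s)
    F-πε r s = Eq.trans (F-⊔ (π r) (ε s)) (⊔-cong (𝐅.π-homo x r) (𝐅.ε-homo x s))

  -- Commuting `E` with iteration and the derived commands

  module _ (x : V) where
    open OneFamily isLocalisation x using () renaming
      (F-⊔ to E-⊔; F-mono to E-mono; F-⊤ to E-⊤; F-idem to E-idem; F-nil to E-nil; F-πε to E-πε)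
    open OneFamily isLocalisation-first x using () renaming
      (F-⊔ to first-⊔; F-⊤ to first-⊤; F-nil to first-nil)
    open OneFamily isLocalisation-last x using () renaming (F-πε to last-πε)

    -- `E-last x c` lies between `c` and `E x c`, and `E` is idempotent.
    E-absorbs-last : ∀ c → E x (E-last x c) ≈ E x c
    E-absorbs-last c = antisym
      (trans (E-mono (last≤E x c)) (reflexive (E-idem c)))
      (E-mono (𝐄-last.extensive x c))

    first-absorbs-E : ∀ c → E-first x (E x c) ≈ E x c
    first-absorbs-E c = antisym
      (trans (first≤E x (E x c)) (reflexive (E-idem c)))
      (𝐄-first.extensive x (E x c))

    -- The form in which `E` is distributed over a composition below: it suffices that the right
    -- factor absorbs `E-first`.
    E-⨾-first-fixed : ∀ c d → E-first x d ≈ d → E x (c ⨾ d) ≈ E x c ⨾ E x d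
    E-⨾-first-fixed c d fd≈d =
      Eq.trans (𝐄.cong x (⨾-cong Eq.refl (Eq.sym fd≈d))) (E-⨾-first x c d)

    module _ {a} (a∈𝒜 : a ∈ 𝒜) (Ea≈last : E x a ≈ E-last x a) where

      E-⨾-atomic : ∀ c → E x (c ⨾ a) ≈ E x c ⨾ E x a
      E-⨾-atomic c = begin
        E x (c ⨾ a)             ≈⟨ E-absorbs-last (c ⨾ a) ⟨
        -- Atomicity of `a` supplies the premise of `last-⨾`.
        E x (E-last x (c ⨾ a))  ≈⟨ 𝐄.cong x (last-⨾ x a c (atomic-⋒ a∈𝒜)) ⟩
        E x (c ⨾ E-last x a)    ≈⟨ 𝐄.cong x (⨾-cong Eq.refl Ea≈last) ⟨
        E x (c ⨾ E x a)         ≈⟨ E-⨾-first-fixed c (E x a) (first-absorbs-E a) ⟩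
        E x c ⨾ E x (E x a)     ≈⟨ ⨾-cong Eq.refl (E-idem a) ⟩
        E x c ⨾ E x a           ∎

      E-^ : ∀ i → E x (a ^ i) ≈ E x a ^ i
      E-^ zero = E-nil
      E-^ (suc i) = begin
        E x (a ^ suc i)      ≈⟨ 𝐄.cong x (^-sucʳ a i) ⟩
        E x (a ^ i ⨾ a)      ≈⟨ E-⨾-atomic (a ^ i) ⟩
        E x (a ^ i) ⨾ E x a  ≈⟨ ⨾-cong (E-^ i) Eq.refl ⟩
        E x a ^ i ⨾ E x a    ≈⟨ ^-sucʳ (E x a) i ⟨
        E x a ^ suc i        ∎

      E-⋆ : E x (a ⋆) ≈ E x a ⋆
      E-⋆ = begin
        E x (a ⋆)                    ≈⟨ 𝐄.cong x (⋆-powers a) ⟩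
        E x (⨆ λ i → a ^ lower i)    ≈⟨ 𝐄.⨆-homo x _ ⟩
        ⨆ (λ i → E x (a ^ lower i))  ≈⟨ ⨆-cong (λ i → E-^ (lower i)) ⟩
        ⨆ (λ i → E x a ^ lower i)    ≈⟨ ⋆-powers (E x a) ⟨
        E x a ⋆                      ∎

      E-ω : E x (a ^ω) ≈ E x a ^ω
      E-ω = begin
        E x (a ^ω)               ≈⟨ 𝐄.cong x (ω-isolation a) ⟩
        E x (a ⋆ ⊔ a ^∞)         ≈⟨ E-⊔ (a ⋆) (a ^∞) ⟩
        -- The finite part comes from the powers; the infinite part is the axiom `E-∞`, under the
        -- same two hypotheses on `a`.
        E x (a ⋆) ⊔ E x (a ^∞)   ≈⟨ ⊔-cong E-⋆ (E-∞ x a∈𝒜 Ea≈last) ⟩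
        E x a ⋆ ⊔ E x a ^∞       ≈⟨ ω-isolation (E x a) ⟨
        E x a ^ω                 ∎

    -- Common source of the results on `guar`, `demand` and `chaos`: each iterates the join of a
    -- program and an environment step, so the condition on the atomic step can be checked on each
    -- half.
    E-ω-πε : ∀ {r s} → Eʳ x r ≐ Eʳ-last x r → Eʳ x s ≐ Eʳ-last x s →
             E x ((π r ⊔ ε s) ^ω) ≈ (π (Eʳ x r) ⊔ ε (Eʳ x s)) ^ω
    E-ω-πε {r} {s} Er≐last Es≐last =
      Eq.trans (E-ω (⊔-closed 𝒜-subalgebra (π-atomic r) (ε-atomic s)) E≈last) (ω-cong (E-πε r s))
      where
      E≈last : E x (π r ⊔ ε s) ≈ E-last x (π r ⊔ ε s)
      E≈last = begin
        E x (π r ⊔ ε s)                    ≈⟨ E-πε r s ⟩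
        π (Eʳ x r) ⊔ ε (Eʳ x s)            ≈⟨ ⊔-cong (π.cong Er≐last) (ε.cong Es≐last) ⟩
        π (Eʳ-last x r) ⊔ ε (Eʳ-last x s)  ≈⟨ last-πε r s ⟨
        E-last x (π r ⊔ ε s)               ∎

    -- Take the environment relation to be `U`, which `Eʳ x` leaves unchanged.
    E-guar : ∀ r → Eʳ x r ≐ Eʳ-last x r → guar (Eʳ x r) ≈ E x (guar r)
    E-guar r Er≐last = begin
      guar (Eʳ x r)                   ≈⟨ ω-cong (⊔-cong Eq.refl (ε.cong (Eʳ-U x))) ⟨
      (π (Eʳ x r) ⊔ ε (Eʳ x U)) ^ω    ≈⟨ E-ω-πε Er≐last (Eʳ-U≐last-U x) ⟨
      E x (guar r)                    ∎

    E-demand : ∀ r → Eʳ x r ≐ Eʳ-last x r → demand (Eʳ x r) ≈ E x (demand r)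
    E-demand r Er≐last = begin
      -- `demand` lists its environment step first, whereas `E-ω-πε` expects the program step there.
      (ε (Eʳ x r) ⊔ 𝛑) ^ω             ≈⟨ ω-cong (⊔-comm _ _) ⟩
      (𝛑 ⊔ ε (Eʳ x r)) ^ω             ≈⟨ ω-cong (⊔-cong (π.cong (Eʳ-U x)) Eq.refl) ⟨
      (π (Eʳ x U) ⊔ ε (Eʳ x r)) ^ω    ≈⟨ E-ω-πε (Eʳ-U≐last-U x) Er≐last ⟨
      E x ((𝛑 ⊔ ε r) ^ω)              ≈⟨ 𝐄.cong x (ω-cong (⊔-comm _ _)) ⟩
      E x (demand r)                  ∎

    E-chaos : E x chaos ≈ chaos
    E-chaos = Eq.trans (E-ω-πε (Eʳ-U≐last-U x) (Eʳ-U≐last-U x))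
                       (ω-cong (⊔-cong (π.cong (Eʳ-U x)) (ε.cong (Eʳ-U x))))

    module _ {s : StateRel} (Es≐s : Eʳ x s ≐ s) where

      -- `ε s` is atomic, so `E-first` acts on it alone and leaves `⊤` untouched; the invariance of
      -- `s` does the rest.
      first-nil-⊔-ε : E-first x (nil ⊔ ε s ⨾ ⊤) ≈ nil ⊔ ε s ⨾ ⊤
      first-nil-⊔-ε = begin
        E-first x (nil ⊔ ε s ⨾ ⊤)              ≈⟨ first-⊔ nil (ε s ⨾ ⊤) ⟩
        E-first x nil ⊔ E-first x (ε s ⨾ ⊤)    ≈⟨ ⊔-cong first-nil (first-⨾ x (ε s) ⊤ (atomic-⋒ (ε-atomic s))) ⟩
        nil ⊔ E-first x (ε s) ⨾ ⊤              ≈⟨ ⊔-cong Eq.refl (⨾-cong (𝐄-first.ε-homo x s) Eq.refl) ⟩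
        nil ⊔ ε (Eʳ-first x s) ⨾ ⊤             ≈⟨ ⊔-cong Eq.refl (⨾-cong (ε.cong (Eʳ-first-fixed x Es≐s)) Eq.refl) ⟩
        nil ⊔ ε s ⨾ ⊤                          ∎

      E-nil-⊔-ε : E x (nil ⊔ ε s ⨾ ⊤) ≈ nil ⊔ ε s ⨾ ⊤
      E-nil-⊔-ε = begin
        E x (nil ⊔ ε s ⨾ ⊤)        ≈⟨ E-⊔ nil (ε s ⨾ ⊤) ⟩
        -- The composition splits because `E-first` fixes `⊤`.
        E x nil ⊔ E x (ε s ⨾ ⊤)    ≈⟨ ⊔-cong E-nil (E-⨾-first-fixed (ε s) ⊤ first-⊤) ⟩
        nil ⊔ E x (ε s) ⨾ E x ⊤    ≈⟨ ⊔-cong Eq.refl (⨾-cong (𝐄.ε-homo x s) E-⊤) ⟩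
        nil ⊔ ε (Eʳ x s) ⨾ ⊤       ≈⟨ ⊔-cong Eq.refl (⨾-cong (ε.cong Es≐s) Eq.refl) ⟩
        nil ⊔ ε s ⨾ ⊤              ∎

    E-rely : ∀ r → Eʳ x r ≐ r → rely (Eʳ x r) ≈ E x (rely r)
    E-rely r Er≐r = begin
      -- By the hypothesis it remains to show that `E x` fixes `rely r`.
      rely (Eʳ x r)                  ≈⟨ ω-cong (⊔-cong Eq.refl (⨾-cong (ε.cong (∁-cong Er≐r)) Eq.refl)) ⟩
      -- The expanded form separates an atomic iteration, to which `E-ω` applies through `E-chaos`,
      -- from a single tail ending in `⊤`.
      rely r                         ≈⟨ rely-expand r ⟩
      chaos ⨾ tail                   ≈⟨ ⨾-cong E-chaos (E-nil-⊔-ε (Eʳ-∁ x Er≐r)) ⟨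
      E x chaos ⨾ E x tail           ≈⟨ E-⨾-first-fixed chaos tail (first-nil-⊔-ε (Eʳ-∁ x Er≐r)) ⟨
      E x (chaos ⨾ tail)             ≈⟨ 𝐄.cong x (rely-expand r) ⟨
      E x (rely r)                   ∎
      where
      tail : Command
      tail = nil ⊔ ε (∁ r) ⨾ ⊤

mainTheorem4 :
  ∀ {ℓ : Level} (V S : Set ℓ) (V-countable : V ↣ ℕ) (A : LocalisationAlgebra V S) →
  let open States V S
      open LocalisationAlgebra A
  in
  ∀ (r : StateRel) (x : V) →
    (Eʳ x r ≐ Eʳ-last x r → guar (Eʳ x r) ≈ E x (guar r)) ×
    (Eʳ x r ≐ Eʳ-last x r → demand (Eʳ x r) ≈ E x (demand r)) ×
    (Eʳ x r ≐ r → rely (Eʳ x r) ≈ E x (rely r))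
mainTheorem4 V S V-countable A r x = E-guar x r , E-demand x r , E-rely x r
  where open LocalisationProperties A
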